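{- Let $s\ge 1$ be an integer and let $G$ be a finite graph. In each of the following cases, there exists an optimal coloring of $G$ such that every tree on $s$ vertices occurs as an induced rainbow subgraph of $G$: (i) $G$ is $K_{2,r}$-free for some integer $r\ge 2$ and $\chi(G)\ge (r-1)(s-1)s/2+s$; (ii) $G$ has girth $g\ge 5$ and $\chi(G)\ge s^{1+4/(g-4)}$.
   Context: An optimal coloring is a proper vertex coloring using exactly $\chi(G)$ colors. $G$ is $K_{2,r}$-free if it has no subgraph (not necessarily induced) isomorphic to $K_{2,r}$. An induced rainbow subgraph is an induced subgraph whose vertices have pairwise distinct colors. -}

module Defs where

open import Data.Nat using (ℕ; zero; suc; _+_; _*_; _∸_; _^_; _≤_; _<_; _<ᵇ_)
open import Data.Nat.DivMod using (_/_)
open import Data.Bool using (Bool; true; false; _xor_)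
open import Data.Fin using (Fin; toℕ)
open import Data.Product using (Σ; _×_; ∃; ∃-syntax)
open import Data.Sum using (_⊎_)
open import Relation.Nullary using (¬_)
open import Relation.Binary.PropositionalEquality using (_≡_; _≢_)
open import Function.Definitions using (Injective)

record Graph (n : ℕ) : Set where
  field
    adj    : Fin n → Fin n → Bool
    sym    : ∀ i j → adj i j ≡ adj j i
    irrefl : ∀ i → adj i i ≡ false
open Graph public

_∼[_]_ : ∀ {n} → Fin n → Graph n → Fin n → Set
u ∼[ G ] v = adj G u v ≡ true

completeBipartite : (a b : ℕ) → Graph (a + b)
completeBipartite a b = record
  { adj = λ i j → (toℕ i <ᵇ a) xor (toℕ j <ᵇ a)
  ; sym = λ i j → xor-comm (toℕ i <ᵇ a) (toℕ j <ᵇ a)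
  ; irrefl = λ i → xor-self (toℕ i <ᵇ a)
  }
  where
  open import Relation.Binary.PropositionalEquality using (refl)
  xor-comm : ∀ x y → x xor y ≡ y xor x
  xor-comm false false = refl
  xor-comm false true = refl
  xor-comm true false = refl
  xor-comm true true = refl
  xor-self : ∀ x → x xor x ≡ false
  xor-self false = refl
  xor-self true = refl

IsSubgraphOf : ∀ {m n} → Graph m → Graph n → Set
IsSubgraphOf {m} {n} H G =
  Σ (Fin m → Fin n) λ f → Injective _≡_ _≡_ f × (∀ i j → i ∼[ H ] j → f i ∼[ G ] f j)

IsInducedEmbedding : ∀ {m n} → Graph m → Graph n → (Fin m → Fin n) → Set
IsInducedEmbedding H G f = Injective _≡_ _≡_ f × (∀ i j → adj H i j ≡ adj G (f i) (f j))

K2r-free : ∀ {n} → ℕ → Graph n → Set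
K2r-free r G = ¬ IsSubgraphOf (completeBipartite 2 r) G

data Reach {n} (G : Graph n) : Fin n → Fin n → Set where
  here : ∀ {u} → Reach G u u
  step : ∀ {u w v} → u ∼[ G ] w → Reach G w v → Reach G u v

Connected : ∀ {n} → Graph n → Set
Connected {n} G = ∀ (u v : Fin n) → Reach G u v

HasCycleOfLength : ∀ {n} → Graph n → ℕ → Set
HasCycleOfLength {n} G ℓ =
  3 ≤ ℓ × Σ (Fin ℓ → Fin n) λ f → Injective _≡_ _≡_ f ×
    (∀ i j → (toℕ j ≡ suc (toℕ i) ⊎ (toℕ i ≡ ℓ ∸ 1 × toℕ j ≡ 0)) → f i ∼[ G ] f j)

Acyclic : ∀ {n} → Graph n → Set
Acyclic G = ∀ ℓ → ¬ HasCycleOfLength G ℓ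

IsTree : ∀ {n} → Graph n → Set
IsTree T = Connected T × Acyclic T

HasGirth : ∀ {n} → Graph n → ℕ → Set
HasGirth G g = HasCycleOfLength G g × (∀ ℓ → ℓ < g → ¬ HasCycleOfLength G ℓ)

IsProperColoring : ∀ {n k} → Graph n → (Fin n → Fin k) → Set
IsProperColoring {n} G c = ∀ (u v : Fin n) → u ∼[ G ] v → c u ≢ c v

Colorable : ∀ {n} → Graph n → ℕ → Set
Colorable {n} G k = Σ (Fin n → Fin k) λ c → IsProperColoring G c

IsChromaticNumber : ∀ {n} → Graph n → ℕ → Set
IsChromaticNumber G k = Colorable G k × (∀ m → m < k → ¬ Colorable G m)

RainbowOn : ∀ {m n k} → (Fin n → Fin k) → (Fin m → Fin n) → Set
RainbowOn c f = Injective _≡_ _≡_ (λ i → c (f i))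

AllTreesInducedRainbow : ∀ {n k} → ℕ → Graph n → (Fin n → Fin k) → Set
AllTreesInducedRainbow {n} s G c =
  ∀ (T : Graph s) → IsTree T →
    Σ (Fin s → Fin n) λ f → IsInducedEmbedding T G f × RainbowOn c f

{-# OPTIONS --safe #-}
-- Take an optimal colouring with least sum of colours, so that every vertex sees all
-- smaller colours. Embed the tree greedily, running through the colours downwards: for
-- each colour, take a neighbour w of that colour of the image of a tree vertex that still
-- has an unembedded neighbour, and reject w if it is adjacent to a second embedded vertex.
-- Suppose all k colours are spent when only n < s vertices are embedded. In case (i) the
-- rejected vertices are too many common neighbours of pairs of embedded vertices. In
-- case (ii), the tree edges and the paths of length two through rejected vertices are the
-- k - 1 edges of a multigraph on the n embedded vertices, which has no cycle of length at
-- most 2a for a = ⌊(g - 1) / 4⌋, as it would give one of length at most 4a < g in G.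
-- Around every vertex some ball of radius less than a grows by a factor at most k / s in
-- the next step, since n < s ≤ (k / s) ^ a, and the edges meeting it form a tree. Deleting
-- such balls one after the other shows that there are fewer than n k / s ≤ k - 1 edges.
module Submission where

open import Defs
open import Data.Nat using (ℕ; suc; _+_; _*_; _∸_; _^_; _≤_)
open import Data.Nat.DivMod using (_/_)
open import Data.Fin using (Fin)
open import Data.Product using (Σ; _×_; ∃-syntax)
open import Data.Sum using (_⊎_)

open import Data.Bool using (Bool; true; false)
import Data.Bool.Properties as Bool
open import Data.Empty using (⊥)
open import Data.Fin using (zero; suc; toℕ; fromℕ<; inject≤; lower₁)
import Data.Fin.Properties as Fin
open import Data.List using (List; []; _∷_; _++_; map; filter; length; lookup; allFin; cartesianProduct)
open import Data.List.Membership.Propositional using (_∈_; _∉_)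
open import Data.List.Membership.Propositional.Properties
  using (∈-∃++; ∈-++⁺ˡ; ∈-++⁺ʳ; ∈-++⁻; ∈-lookup; ∈-filter⁺; ∈-filter⁻; ∈-map⁺; ∈-map⁻;
         ∈-allFin; ∈-cartesianProduct⁺; ∈-cartesianProduct⁻)
open import Data.List.Properties using (length-++; length-map; length-tabulate)
open import Data.List.Relation.Unary.All as All using ([]; _∷_)
open import Data.List.Relation.Unary.All.Properties using (¬Any⇒All¬)
open import Data.List.Relation.Unary.AllPairs using ([]; _∷_)
open import Data.List.Relation.Unary.Any as Any using (here; there)
open import Data.List.Relation.Unary.Unique.Propositional using (Unique)
import Data.List.Relation.Unary.Unique.Propositional.Properties as Unique
open import Data.Nat using (zero; _<_; z≤n; s≤s; s≤s⁻¹; NonZero; >-nonZero; _≟_; _≤?_; _<?_)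
open import Data.Nat.DivMod using (_%_; m≡m%n+[m/n]*n; m%n<n; m/n*n≤m)
open import Data.Nat.Induction using (<-wellFounded)
open import Data.Nat.Properties hiding (_≟_; _≤?_; _<?_)
open import Data.Product using (∃; _,_; proj₁; proj₂)
open import Data.Product.Properties using (≡-dec)
open import Data.Sum using (inj₁; inj₂)
open import Function using (_∘_; case_of_)
open import Function.Definitions using (Injective)
open import Induction.WellFounded using (Acc; acc)
open import Level using (0ℓ)
open import Relation.Binary using (Rel; DecidableEquality)
open import Relation.Binary.PropositionalEquality renaming (sym to ≡-sym)
open import Relation.Nullary using (¬_; Dec; yes; no; contradiction)
open import Relation.Nullary.Decidable using (¬?; _×-dec_; _⊎-dec_; decidable-stable)
open import Relation.Unary using (Pred; Decidable)

open import Algebra.Properties.CommutativeSemigroup *-commutativeSemigroup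
  using (x∙yz≈y∙xz; x∙yz≈zx∙y)

-- Counting with duplicate-free lists

unique-⊆⇒length≤ : ∀ {A : Set} {xs ys : List A} → Unique xs → (∀ {z} → z ∈ xs → z ∈ ys) →
  length xs ≤ length ys
unique-⊆⇒length≤ [] sub = z≤n
unique-⊆⇒length≤ {xs = x ∷ xs} (x≢ ∷ u) sub with ∈-∃++ (sub (here refl))
... | as , bs , refl = begin
  suc (length xs)             ≤⟨ s≤s (unique-⊆⇒length≤ u sub′) ⟩
  suc (length (as ++ bs))     ≡⟨ cong suc (length-++ as) ⟩
  suc (length as + length bs) ≡⟨ +-suc (length as) (length bs) ⟨
  length as + suc (length bs) ≡⟨ length-++ as ⟨
  length (as ++ x ∷ bs)       ∎
  where
  open ≤-Reasoning
  sub′ : ∀ {z} → z ∈ xs → z ∈ as ++ bs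
  sub′ z∈ with ∈-++⁻ as (sub (there z∈))
  ... | inj₁ z∈as = ∈-++⁺ˡ z∈as
  ... | inj₂ (here refl) = contradiction refl (All.lookup x≢ z∈)
  ... | inj₂ (there z∈bs) = ∈-++⁺ʳ as z∈bs

length-filter-split : ∀ {A : Set} {P : Pred A 0ℓ} (P? : Decidable P) (xs : List A) →
  length (filter P? xs) + length (filter (¬? ∘ P?) xs) ≡ length xs
length-filter-split P? [] = refl
length-filter-split P? (x ∷ xs) with P? x
... | yes _ = cong suc (length-filter-split P? xs)
... | no _ = trans (+-suc _ _) (cong suc (length-filter-split P? xs))

unique-lookup-injective : ∀ {A : Set} {xs : List A} → Unique xs → Injective _≡_ _≡_ (lookup xs)
unique-lookup-injective (x≢ ∷ u) {zero} {zero} eq = refl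
unique-lookup-injective {xs = x ∷ xs} (x≢ ∷ u) {zero} {suc j} eq =
  contradiction eq (All.lookup x≢ (∈-lookup j))
unique-lookup-injective {xs = x ∷ xs} (x≢ ∷ u) {suc i} {zero} eq =
  contradiction (≡-sym eq) (All.lookup x≢ (∈-lookup i))
unique-lookup-injective (x≢ ∷ u) {suc i} {suc j} eq = cong suc (unique-lookup-injective u eq)

-- Walks and cycles

-- The list records every vertex visited, both ends included, so a duplicate-free walk closed by one
-- edge is a cycle of length `length vs`.
data Walk {A : Set} (R : Rel A 0ℓ) : A → A → List A → Set where
  [_]  : ∀ x → Walk R x x (x ∷ [])
  _∷_ : ∀ {x y z vs} → R x y → Walk R y z vs → Walk R x z (x ∷ vs)

module _ {A : Set} {R : Rel A 0ℓ} where

  snoc : ∀ {x y z vs} → Walk R x y vs → R y z → Walk R x z (vs ++ z ∷ [])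
  snoc [ x ] r = r ∷ [ _ ]
  snoc (r′ ∷ w) r = r′ ∷ snoc w r

  mapWalk : ∀ {S : Rel A 0ℓ} → (∀ {x y} → R x y → S x y) →
    ∀ {x y vs} → Walk R x y vs → Walk S x y vs
  mapWalk f [ x ] = [ x ]
  mapWalk f (r ∷ w) = f r ∷ mapWalk f w

  suffix : ∀ {x y z vs} → Walk R y z vs → Unique vs → x ∈ vs →
    ∃ λ ws → Walk R x z ws × Unique ws × length ws ≤ length vs
  suffix [ x ] u (here refl) = _ , [ x ] , u , ≤-refl
  suffix (r ∷ w) u (here refl) = _ , r ∷ w , u , ≤-refl
  suffix (r ∷ w) (_ ∷ u) (there x∈) with suffix w u x∈
  ... | ws , w′ , u′ , le = ws , w′ , u′ , m≤n⇒m≤1+n le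

  module _ (_≟A_ : DecidableEquality A) where
    open import Data.List.Membership.DecPropositional _≟A_ using (_∈?_)

    -- If the erased tail returns to `x`, its suffix from `x` on replaces the whole walk.
    loopErase : ∀ {x z vs} → Walk R x z vs →
      ∃ λ ws → Walk R x z ws × Unique ws × length ws ≤ length vs
    loopErase [ x ] = _ , [ x ] , [] ∷ [] , ≤-refl
    loopErase {x} (r ∷ w) with loopErase w
    ... | ws , w′ , u , le with x ∈? ws
    ...   | no x∉ = _ , r ∷ w′ , ¬Any⇒All¬ ws x∉ ∷ u , s≤s le
    ...   | yes x∈ with suffix w′ u x∈
    ...     | ws′ , w″ , u′ , le′ = ws′ , w″ , u′ , ≤-trans le′ (m≤n⇒m≤1+n le)

  walk-first : ∀ {x z vs} → Walk R x z vs → ∀ i → toℕ i ≡ 0 → lookup vs i ≡ x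
  walk-first [ x ] zero _ = refl
  walk-first (_ ∷ _) zero _ = refl

  walk-last : ∀ {x z vs} → Walk R x z vs → ∀ i → toℕ i ≡ length vs ∸ 1 → lookup vs i ≡ z
  walk-last [ x ] zero _ = refl
  walk-last (_ ∷ [ x ]) (suc zero) _ = refl
  walk-last (_ ∷ (r ∷ w)) (suc i) eq = walk-last (r ∷ w) i (suc-injective eq)

  walk-step : ∀ {x z vs} → Walk R x z vs → ∀ i j → toℕ j ≡ suc (toℕ i) →
    R (lookup vs i) (lookup vs j)
  walk-step (r ∷ w) zero (suc j) eq = subst (R _) (≡-sym (walk-first w j (suc-injective eq))) r
  walk-step (r ∷ w) (suc i) (suc j) eq = walk-step w i j (suc-injective eq)
  walk-step [ x ] zero zero ()

∼-sym : ∀ {n} (G : Graph n) {u v} → u ∼[ G ] v → v ∼[ G ] u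
∼-sym G {u} {v} e = trans (Graph.sym G v u) e

∼⇒≢ : ∀ {n} (G : Graph n) {u v} → u ∼[ G ] v → u ≢ v
∼⇒≢ G {u} e refl with trans (≡-sym e) (irrefl G u)
... | ()

-- Closing the loop-erased walk with the edge vu gives a cycle, because the walk
-- never makes the step from u to v and so has at least three vertices.
detour⇒cycle : ∀ {n} (G : Graph n) {R : Rel (Fin n) 0ℓ} {u v vs} → u ∼[ G ] v →
  (∀ {x y} → R x y → x ∼[ G ] y) → ¬ R u v → Walk R u v vs →
  ∃ λ ℓ → ℓ ≤ length vs × HasCycleOfLength G ℓ
detour⇒cycle {n} G {R} {u} {v} uv R⇒∼ ¬R w with loopErase Fin._≟_ w
... | ws , w′ , un , le = length ws , le , three w′ , lookup ws , unique-lookup-injective un , edge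
  where
  three : ∀ {ws} → Walk R u v ws → 3 ≤ length ws
  three [ x ] = contradiction refl (∼⇒≢ G uv)
  three (r ∷ [ x ]) = contradiction r ¬R
  three (_ ∷ (_ ∷ [ _ ])) = s≤s (s≤s (s≤s z≤n))
  three (_ ∷ (_ ∷ (_ ∷ _))) = s≤s (s≤s (s≤s z≤n))
  edge : ∀ i j → (toℕ j ≡ suc (toℕ i) ⊎ (toℕ i ≡ length ws ∸ 1 × toℕ j ≡ 0)) →
    lookup ws i ∼[ G ] lookup ws j
  edge i j (inj₁ eq) = R⇒∼ (walk-step w′ i j eq)
  edge i j (inj₂ (eq , eq′)) rewrite walk-last w′ i eq | walk-first w′ j eq′ = ∼-sym G uv

-- Grundy colourings

IsGrundy : ∀ {n k} → Graph n → (Fin n → Fin k) → Set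
IsGrundy {n} {k} G c = ∀ v (j : Fin k) → toℕ j < toℕ (c v) → ∃ λ u → v ∼[ G ] u × c u ≡ j

total : ∀ {n} → (Fin n → ℕ) → ℕ
total {zero} f = 0
total {suc n} f = f zero + total (f ∘ suc)

total-mono : ∀ {n} {f g : Fin n → ℕ} → (∀ i → f i ≤ g i) → total f ≤ total g
total-mono {zero} f≤g = z≤n
total-mono {suc n} f≤g = +-mono-≤ (f≤g zero) (total-mono (f≤g ∘ suc))

total-strict : ∀ {n} {f g : Fin n → ℕ} → (∀ i → f i ≤ g i) → ∀ v → f v < g v → total f < total g
total-strict f≤g zero f<g = +-mono-<-≤ f<g (total-mono (f≤g ∘ suc))
total-strict f≤g (suc v) f<g = +-mono-≤-< (f≤g zero) (total-strict (f≤g ∘ suc) v f<g)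

-- A proper colouring with least sum of colours is Grundy: otherwise some vertex
-- could be moved to a smaller colour.
grundyColoring : ∀ {n k} (G : Graph n) (c : Fin n → Fin k) → IsProperColoring G c →
  ∃ λ (c′ : Fin n → Fin k) → IsProperColoring G c′ × IsGrundy G c′
grundyColoring {n} {k} G c₀ proper₀ = go c₀ proper₀ (<-wellFounded _)
  where
  go : ∀ c → IsProperColoring G c → Acc _<_ (total (toℕ ∘ c)) →
    ∃ λ c′ → IsProperColoring G c′ × IsGrundy G c′
  go c proper (acc rec)
    with Fin.any? (λ v → Fin.any? (λ j → (toℕ j <? toℕ (c v)) ×-dec
           ¬? (Fin.any? (λ u → (adj G v u Bool.≟ true) ×-dec (c u Fin.≟ j)))))
  ... | no none = c , proper , λ v j j<c →
          decidable-stable (Fin.any? (λ u → (adj G v u Bool.≟ true) ×-dec (c u Fin.≟ j)))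
            (λ ¬nb → none (v , j , j<c , ¬nb))
  ... | yes (v , j , j<c , ¬nb) = go c′ proper′ (rec (total-strict c′≤c v c′<c))
    where
    c′ : Fin n → Fin k
    c′ u with u Fin.≟ v
    ... | yes _ = j
    ... | no _ = c u
    proper′ : IsProperColoring G c′
    proper′ x y xy eq with x Fin.≟ v | y Fin.≟ v
    ... | yes refl | yes refl = ∼⇒≢ G xy refl
    ... | yes refl | no _ = ¬nb (y , xy , ≡-sym eq)
    ... | no _ | yes refl = ¬nb (x , ∼-sym G xy , eq)
    ... | no _ | no _ = proper x y xy eq
    c′≤c : ∀ u → toℕ (c′ u) ≤ toℕ (c u)
    c′≤c u with u Fin.≟ v
    ... | yes refl = <⇒≤ j<c
    ... | no _ = ≤-refl
    c′<c : toℕ (c′ v) < toℕ (c v)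
    c′<c with v Fin.≟ v
    ... | yes _ = j<c
    ... | no v≢v = contradiction refl v≢v

-- Otherwise the same colouring would fit into `Fin K`. The vertex found here becomes the first
-- embedded one, with every other colour below it.
topColour-used : ∀ {n K} (G : Graph n) (c : Fin n → Fin (suc K)) → IsProperColoring G c →
  ¬ Colorable G K → ∃ λ v → toℕ (c v) ≡ K
topColour-used {n} {K} G c proper ¬col with Fin.any? (λ v → toℕ (c v) ≟ K)
... | yes top = top
... | no ¬top = contradiction ((λ v → lower₁ (c v) (K≢ v)) , proper′) ¬col
  where
  K≢ : ∀ v → K ≢ toℕ (c v)
  K≢ v eq = ¬top (v , ≡-sym eq)
  proper′ : IsProperColoring G (λ v → lower₁ (c v) (K≢ v))
  proper′ u v uv eq = proper u v uv (Fin.lower₁-injective {n≢i = K≢ u} {K≢ v} eq)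

_∈F?_ : ∀ {n} (x : Fin n) (xs : List (Fin n)) → Dec (x ∈ xs)
x ∈F? xs = Any.any? (x Fin.≟_) xs

-- The greedy embedding

module Greedy {N K s : ℕ} (G : Graph N) (c : Fin N → Fin (suc K)) (grundy : IsGrundy G c) where

  col : Fin N → ℕ
  col v = toℕ (c v)

  -- How the colour i was spent while embedding a tree at the vertices xs: w is either
  -- itself embedded, or it was rejected because of its second neighbour a in xs.
  record Link (xs : List (Fin N)) (i : ℕ) : Set where
    field
      w a b : Fin N
      a∈  : a ∈ xs
      b∈  : b ∈ xs
      a≢b : a ≢ b
      col-w : col w ≡ i
      i<b : i < col b
      wb  : w ∼[ G ] b
      wa  : w ≡ a ⊎ (w ∼[ G ] a × i < col a)

  weaken : ∀ {xs x i} → Link xs i → Link (x ∷ xs) i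
  weaken l = record
    { w = w ; a = a ; b = b ; a∈ = there a∈ ; b∈ = there b∈ ; a≢b = a≢b
    ; col-w = col-w ; i<b = i<b ; wb = wb ; wa = wa }
    where open Link l

  record Stuck : Set where
    field
      root : Fin N
      xs : List (Fin N)
      root-col : col root ≡ K
      root∈ : root ∈ xs
      xs-unique : Unique xs
      few : length xs < s
      links : ∀ i → i < K → Link xs i

  module _ (T : Graph s) (tree : IsTree T) where

    Embeds : Set
    Embeds = Σ (Fin s → Fin N) λ f → IsInducedEmbedding T G f × RainbowOn c f

    verts : List (Fin s × Fin N) → List (Fin s)
    verts = map proj₁

    images : List (Fin s × Fin N) → List (Fin N)
    images = map proj₂

    -- Constraining the target of each step is enough to keep a walk from ever entering a vertex
    -- outside `ts`.
    Inside : List (Fin s) → Rel (Fin s) 0ℓ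
    Inside ts x y = x ∼[ T ] y × y ∈ ts

    -- The partial embedding once the colours m, …, K have been spent.
    record State (m : ℕ) : Set where
      field
        ps : List (Fin s × Fin N)
        ts-unique : Unique (verts ps)
        xs-unique : Unique (images ps)
        rainbow : ∀ {p q} → p ∈ ps → q ∈ ps → col (proj₂ p) ≡ col (proj₂ q) → p ≡ q
        m≤col : ∀ {p} → p ∈ ps → m ≤ col (proj₂ p)
        induced : ∀ {p q} → p ∈ ps → q ∈ ps →
          adj T (proj₁ p) (proj₁ q) ≡ adj G (proj₂ p) (proj₂ q)
        connected : ∀ {t u} → t ∈ verts ps → u ∈ verts ps → ∃ λ vs → Walk (Inside (verts ps)) t u vs
        links : ∀ i → m ≤ i → i < K → Link (images ps) i
        root : Fin N
        root-col : col root ≡ K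
        root∈ : root ∈ images ps
    open State

    complete : ∀ {m} (S : State m) → (∀ t → t ∈ verts (ps S)) → Embeds
    complete S all = f , (inj , λ i j → induced S (f∈ i) (f∈ j)) , rb
      where
      image : ∀ t → ∃ λ x → (t , x) ∈ ps S
      image t with ∈-map⁻ proj₁ (all t)
      ... | (_ , x) , p∈ , refl = x , p∈
      f : Fin s → Fin N
      f = proj₁ ∘ image
      f∈ : ∀ t → (t , f t) ∈ ps S
      f∈ = proj₂ ∘ image
      rb : RainbowOn c f
      rb {i} {j} eq = cong proj₁ (rainbow S (f∈ i) (f∈ j) (cong toℕ eq))
      inj : ∀ {i j} → f i ≡ f j → i ≡ j
      inj eq = rb (cong c eq)

    -- The first step that leaves `ts` on the way from `t` to `u` is the tree edge along which the
    -- embedding is extended next.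
    boundary : ∀ {ts : List (Fin s)} {t u} → t ∈ ts → u ∉ ts → Reach T t u →
      ∃ λ x → ∃ λ y → x ∈ ts × y ∉ ts × x ∼[ T ] y
    boundary t∈ u∉ here = contradiction t∈ u∉
    boundary {ts} t∈ u∉ (step {w = w} tw r) with w ∈F? ts
    ... | yes w∈ = boundary w∈ u∉ r
    ... | no w∉ = _ , w , t∈ , w∉ , tw

    -- A second neighbour `q` would close a cycle in the tree: walk from `x` to `q` inside the
    -- embedded part, which misses `t`, then go to `t` and back along the edge to `x`.
    unique-attachment : ∀ {m} (S : State m) {t x q} → t ∉ verts (ps S) → x ∈ verts (ps S) →
      x ∼[ T ] t → q ∈ verts (ps S) → q ≢ x → ¬ q ∼[ T ] t
    unique-attachment S {t} {x} {q} t∉ x∈ xt q∈ q≢x qt with connected S x∈ q∈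
    ... | vs , w with detour⇒cycle T {λ y z → y ∼[ T ] z × ¬ (y ≡ x × z ≡ t)} xt proj₁
                       (λ (_ , ne) → ne (refl , refl))
                       (snoc (mapWalk (λ { (e , z∈) → e , λ { (_ , refl) → t∉ z∈ } }) w) (qt , q≢x ∘ proj₁))
    ...   | ℓ , _ , cyc = proj₂ tree ℓ cyc

    reject : ∀ {m} (S : State (suc m)) → Link (images (ps S)) m → State m
    reject {m} S l = record
      { ps = ps S ; ts-unique = ts-unique S ; xs-unique = xs-unique S ; rainbow = rainbow S
      ; m≤col = λ p∈ → ≤-trans (n≤1+n m) (m≤col S p∈) ; induced = induced S ; connected = connected S
      ; links = links′ ; root = root S ; root-col = root-col S ; root∈ = root∈ S }
      where
      links′ : ∀ i → m ≤ i → i < K → Link (images (ps S)) i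
      links′ i m≤i i<K with m ≟ i
      ... | yes refl = l
      ... | no m≢i = links S i (≤∧≢⇒< m≤i m≢i) i<K

    -- The embedding stays induced because `x` is the only embedded neighbour of `t` in the tree
    -- and, by the last hypothesis, `y` is the only embedded neighbour of `w` in `G`. It stays
    -- rainbow because the colour `m` is below all earlier ones.
    accept : ∀ {m} (S : State (suc m)) {t x y w} → t ∉ verts (ps S) → (x , y) ∈ ps S →
      x ∼[ T ] t → y ∼[ G ] w → col w ≡ m →
      (∀ {p} → p ∈ ps S → proj₂ p ≢ y → ¬ w ∼[ G ] proj₂ p) → State m
    accept {m} S {t} {x} {y} {w} t∉ xy∈ xt yw cw alone = record
      { ps = ps′
      ; ts-unique = ¬Any⇒All¬ _ t∉ ∷ ts-unique S
      ; xs-unique = ¬Any⇒All¬ _ w∉ ∷ xs-unique S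
      ; rainbow = rainbow′
      ; m≤col = λ { (here refl) → ≤-reflexive (≡-sym cw) ; (there p∈) → <⇒≤ (m≤col S p∈) }
      ; induced = induced′
      ; connected = connected′
      ; links = links′
      ; root = root S ; root-col = root-col S ; root∈ = there (root∈ S) }
      where
      ps′ : List (Fin s × Fin N)
      ps′ = (t , w) ∷ ps S
      lower : ∀ {p} → p ∈ ps S → col w ≢ col (proj₂ p)
      lower p∈ eq = <-irrefl (trans (≡-sym cw) eq) (m≤col S p∈)
      w∉ : w ∉ images (ps S)
      w∉ w∈ with ∈-map⁻ proj₂ w∈
      ... | p , p∈ , refl = lower p∈ refl
      rainbow′ : ∀ {p q} → p ∈ ps′ → q ∈ ps′ → col (proj₂ p) ≡ col (proj₂ q) → p ≡ q
      rainbow′ (here refl) (here refl) eq = refl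
      rainbow′ (here refl) (there q∈) eq = contradiction eq (lower q∈)
      rainbow′ (there p∈) (here refl) eq = contradiction (≡-sym eq) (lower p∈)
      rainbow′ (there p∈) (there q∈) eq = rainbow S p∈ q∈ eq
      new : ∀ {p} → p ∈ ps S → adj T t (proj₁ p) ≡ adj G w (proj₂ p)
      new {q , z} p∈ with z Fin.≟ y
      ... | yes refl with rainbow S p∈ xy∈ refl
      ...   | refl = trans (∼-sym T xt) (≡-sym (∼-sym G yw))
      new {q , z} p∈ | no z≢y = trans (Bool.¬-not nonT) (≡-sym (Bool.¬-not (alone p∈ z≢y)))
        where
        q≢x : q ≢ x
        q≢x refl = z≢y (only (ts-unique S) p∈ xy∈)
          where
          only : ∀ {qs : List (Fin s × Fin N)} {z z′} → Unique (verts qs) →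
            (x , z) ∈ qs → (x , z′) ∈ qs → z ≡ z′
          only u (here refl) (here refl) = refl
          only (x≢ ∷ u) (here refl) (there q∈) = contradiction refl (All.lookup x≢ (∈-map⁺ proj₁ q∈))
          only (x≢ ∷ u) (there q∈) (here refl) = contradiction refl (All.lookup x≢ (∈-map⁺ proj₁ q∈))
          only (x≢ ∷ u) (there q∈) (there q∈′) = only u q∈ q∈′
        nonT : ¬ t ∼[ T ] q
        nonT tq = unique-attachment S t∉ (∈-map⁺ proj₁ xy∈) xt (∈-map⁺ proj₁ p∈) q≢x (∼-sym T tq)
      induced′ : ∀ {p q} → p ∈ ps′ → q ∈ ps′ →
        adj T (proj₁ p) (proj₁ q) ≡ adj G (proj₂ p) (proj₂ q)
      induced′ (here refl) (here refl) = trans (irrefl T t) (≡-sym (irrefl G w))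
      induced′ (here refl) (there q∈) = new q∈
      induced′ (there p∈) (here refl) = trans (Graph.sym T _ t) (trans (new p∈) (Graph.sym G w _))
      induced′ (there p∈) (there q∈) = induced S p∈ q∈
      x∈ : x ∈ verts (ps S)
      x∈ = ∈-map⁺ proj₁ xy∈
      larger : ∀ {u v vs} → Walk (Inside (verts (ps S))) u v vs → Walk (Inside (verts ps′)) u v vs
      larger = mapWalk λ (e , z∈) → e , there z∈
      connected′ : ∀ {u v} → u ∈ verts ps′ → v ∈ verts ps′ → ∃ λ vs → Walk (Inside (verts ps′)) u v vs
      connected′ (here refl) (here refl) = _ , [ t ]
      connected′ (here refl) (there v∈) =
        _ , (∼-sym T xt , there x∈) ∷ larger (proj₂ (connected S x∈ v∈))
      connected′ (there u∈) (here refl) =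
        _ , snoc (larger (proj₂ (connected S u∈ x∈))) (xt , here refl)
      connected′ (there u∈) (there v∈) = _ , larger (proj₂ (connected S u∈ v∈))
      links′ : ∀ i → m ≤ i → i < K → Link (images ps′) i
      links′ i m≤i i<K with m ≟ i
      -- The colour of an accepted vertex is accounted for by the new tree edge from `w` to `y`.
      ... | yes refl = record
              { w = w ; a = w ; b = y ; a∈ = here refl ; b∈ = there (∈-map⁺ proj₂ xy∈)
              ; a≢b = λ w≡y → ∼⇒≢ G yw (≡-sym w≡y) ; col-w = cw ; i<b = m≤col S xy∈
              ; wb = ∼-sym G yw ; wa = inj₁ refl }
      ... | no m≢i = weaken (links S i (≤∧≢⇒< m≤i m≢i) i<K)

    -- As `t₀` is missing, some tree edge leads from an embedded `x` to an unembedded `t`. The image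
    -- `y` of `x` has a colour above `m`, so the Grundy property gives it a neighbour `w` of colour
    -- `m`, the candidate for the image of `t`.
    advance : ∀ {m} → m < suc K → (S : State (suc m)) → ∀ {t} → t ∉ verts (ps S) → State m
    advance {m} m<k S {t₀} t₀∉ with ∈-map⁻ proj₂ (root∈ S)
    ... | p₀ , p₀∈ , _ with boundary (∈-map⁺ proj₁ p₀∈) t₀∉ (proj₁ tree (proj₁ p₀) t₀)
    ...   | x , t , x∈ , t∉ , xt with ∈-map⁻ proj₁ x∈
    ...     | (_ , y) , xy∈ , refl
              with grundy y (fromℕ< m<k) (subst (_< col y) (≡-sym (Fin.toℕ-fromℕ< m<k)) (m≤col S xy∈))
    ...       | w , yw , cw = choose (Fin.any? λ z →
                  (z ∈F? images (ps S)) ×-dec (¬? (z Fin.≟ y) ×-dec (adj G w z Bool.≟ true)))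
      where
      col-w : col w ≡ m
      col-w = trans (cong toℕ cw) (Fin.toℕ-fromℕ< m<k)
      choose : Dec (∃ λ z → z ∈ images (ps S) × (z ≢ y × w ∼[ G ] z)) → State m
      choose (no none) = accept S t∉ xy∈ xt yw col-w
        (λ p∈ z≢y wz → none (_ , ∈-map⁺ proj₂ p∈ , z≢y , wz))
      choose (yes (z , z∈ , z≢y , wz)) with ∈-map⁻ proj₂ z∈
      ... | q , q∈ , refl = reject S (record
              { w = w ; a = z ; b = y ; a∈ = z∈ ; b∈ = ∈-map⁺ proj₂ xy∈ ; a≢b = z≢y
              ; col-w = col-w ; i<b = m≤col S xy∈ ; wb = ∼-sym G yw ; wa = inj₂ (wz , m≤col S q∈) })

    run : ∀ m → m ≤ K → State m → Embeds ⊎ Stuck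
    run m m≤K S with Fin.any? (λ t → ¬? (t ∈F? verts (ps S)))
    ... | no none = inj₁ (complete S λ t → decidable-stable (t ∈F? verts (ps S)) (λ t∉ → none (t , t∉)))
    run zero _ S | yes (t , t∉) = inj₂ (record
      { root = root S ; xs = images (ps S) ; root-col = root-col S ; root∈ = root∈ S
      ; xs-unique = xs-unique S ; few = few ; links = λ i → links S i z≤n })
      where
      few : length (images (ps S)) < s
      few = subst₂ _≤_ (cong suc (trans (length-map proj₁ (ps S)) (≡-sym (length-map proj₂ (ps S)))))
        (length-tabulate {n = s} (λ i → i))
        (unique-⊆⇒length≤ {ys = allFin s} (¬Any⇒All¬ _ t∉ ∷ ts-unique S) (λ {z} _ → ∈-allFin z))
    run (suc m) m<K S | yes (t , t∉) =
      run m (<⇒≤ m<K) (advance (m≤n⇒m≤1+n m<K) S t∉)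

    embed-or-stuck : (root : Fin N) → col root ≡ K → Fin s → Embeds ⊎ Stuck
    embed-or-stuck root root-col t = run K ≤-refl (record
      { ps = (t , root) ∷ []
      ; ts-unique = [] ∷ [] ; xs-unique = [] ∷ []
      ; rainbow = λ { (here refl) (here refl) _ → refl }
      ; m≤col = λ { (here refl) → ≤-reflexive (≡-sym root-col) }
      ; induced = λ { (here refl) (here refl) → trans (irrefl T t) (≡-sym (irrefl G root)) }
      ; connected = λ { (here refl) (here refl) → _ , [ t ] }
      ; links = λ i K≤i i<K → contradiction K≤i (<⇒≱ i<K)
      ; root = root ; root-col = root-col ; root∈ = here refl })

-- Multigraphs without short cycles

module Multigraph {A E : Set} (_≟A_ : DecidableEquality A) (_≟E_ : DecidableEquality E)
  (src tgt : E → A) where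

  open import Data.List.Membership.DecPropositional _≟A_ using () renaming (_∈?_ to _∈A?_)
  open import Data.List.Membership.DecPropositional _≟E_ using () renaming (_∈?_ to _∈E?_)

  -- Edges are individual objects that can be traversed both ways, so a path avoiding `e` may still
  -- use an edge parallel to `e`.
  data Path (P : E → Set) : A → A → ℕ → Set where
    []      : ∀ {x} → Path P x x 0
    forth : ∀ {e y l} → P e → Path P (tgt e) y l → Path P (src e) y (suc l)
    back  : ∀ {e y l} → P e → Path P (src e) y l → Path P (tgt e) y (suc l)

  mapPath : ∀ {P Q : E → Set} → (∀ {e} → P e → Q e) → ∀ {x y l} → Path P x y l → Path Q x y l
  mapPath f [] = []
  mapPath f (forth p w) = forth (f p) (mapPath f w)
  mapPath f (back p w) = back (f p) (mapPath f w)

  _+++_ : ∀ {P x y z l m} → Path P x y l → Path P y z m → Path P x z (l + m)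
  [] +++ w = w
  forth p v +++ w = forth p (v +++ w)
  back p v +++ w = back p (v +++ w)

  reversePath : ∀ {P x y l} → Path P x y l → Path P y x l
  reversePath [] = []
  reversePath {l = suc l} (forth p w) =
    subst (Path _ _ _) (+-comm l 1) (reversePath w +++ back p [])
  reversePath {l = suc l} (back p w) =
    subst (Path _ _ _) (+-comm l 1) (reversePath w +++ forth p [])

  Incident : List A → E → Set
  Incident B e = src e ∈ B ⊎ tgt e ∈ B

  incident? : ∀ B → Decidable (Incident B)
  incident? B e = (src e ∈A? B) ⊎-dec (tgt e ∈A? B)

  -- The first inequality says that `s` is at most the `a`-th power of k / s, with denominators
  -- cleared. `detour-long` excludes cycles of length at most `2 * a`, each cycle being viewed as
  -- one edge `e` and a path around it.
  module Sparse (a s k : ℕ) (s>0 : 0 < s) (s^≤k^ : s ^ suc a ≤ k ^ a)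
    (detour-long : ∀ e {l} → Path (_≢ e) (src e) (tgt e) l → 2 * a ≤ l) where

    module Ball (vs : List A) (es : List E) (es-unique : Unique es)
      (ends∈ : ∀ {e} → e ∈ es → src e ∈ vs × tgt e ∈ vs) (v : A) where

      Within : List E → A → ℕ → Set
      Within F z r = ∃ λ l → l ≤ r × Path (_∈ F) v z l

      within-mono : ∀ {F F′ z r r′} → (∀ {e} → e ∈ F → e ∈ F′) → r ≤ r′ →
        Within F z r → Within F′ z r′
      within-mono sub r≤ (l , l≤ , w) = l , ≤-trans l≤ r≤ , mapPath sub w

      -- F spans the vertex list B by a tree of depth at most r rooted at v.
      record Tree (r : ℕ) : Set where
        field
          B : List A
          F : List E
          B-unique : Unique B
          B⊆ : ∀ {z} → z ∈ B → z ∈ vs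
          root∈ : v ∈ B
          depth : ∀ {z} → z ∈ B → Within F z r
          F<B : length F < length B
      open Tree

      deepen : ∀ {r} → Tree r → Tree (suc r)
      deepen t = record
        { B = B t ; F = F t ; B-unique = B-unique t ; B⊆ = B⊆ t ; root∈ = root∈ t
        ; depth = within-mono (λ z → z) (n≤1+n _) ∘ depth t ; F<B = F<B t }

      extend : ∀ {r} (T : Tree (suc r)) (e : E) {z : A} → z ∈ vs → z ∉ B T →
        Within (e ∷ F T) z (suc r) → Tree (suc r)
      extend T e {z} z∈vs z∉ wz = record
        { B = z ∷ B T ; F = e ∷ F T
        ; B-unique = ¬Any⇒All¬ _ z∉ ∷ B-unique T
        ; B⊆ = λ { (here refl) → z∈vs ; (there q) → B⊆ T q }
        ; root∈ = there (root∈ T)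
        ; depth = λ { (here refl) → wz ; (there q) → within-mono there ≤-refl (depth T q) }
        ; F<B = s≤s (F<B T) }

      record Grown {r} (T : Tree r) (todo : List E) : Set where
        field
          T′ : Tree (suc r)
          F-mono : ∀ {e} → e ∈ F T → e ∈ F T′
          covers : ∀ {e} → e ∈ todo → Incident (B T) e → e ∈ F T′
      open Grown

      -- The paths from the root `v` to `x` and to `y` avoid `e` and together form a detour around
      -- it of length below `2 * a`.
      closes : ∀ {r r′ F e x y} → r + r′ < 2 * a → e ∉ F → Within F x r → Within F y r′ →
        (src e ≡ x × tgt e ≡ y) ⊎ (tgt e ≡ x × src e ≡ y) → ⊥
      closes {r} {r′} {F} {e} short e∉ (l , l≤ , w) (l′ , l′≤ , w′) ends =
        <-irrefl refl (<-≤-trans (≤-<-trans (+-mono-≤ l≤ l′≤) short) (long ends))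
        where
        avoid : ∀ {e′} → e′ ∈ F → e′ ≢ e
        avoid e∈ refl = e∉ e∈
        long : (src e ≡ _ × tgt e ≡ _) ⊎ (tgt e ≡ _ × src e ≡ _) → 2 * a ≤ l + l′
        long (inj₁ (refl , refl)) = detour-long e (mapPath avoid (reversePath w +++ w′))
        long (inj₂ (refl , refl)) = subst (2 * a ≤_) (+-comm l′ l)
          (detour-long e (mapPath avoid (reversePath w′ +++ w)))

      -- An edge that meets the old ball and is not yet in the tree has its other end outside the
      -- new ball, by `closes`; it is added together with that end as a leaf.
      grow : ∀ {r} → suc r ≤ a → (T : Tree r) (todo : List E) → (∀ {e} → e ∈ todo → e ∈ es) →
        Grown T todo
      grow r<a T [] sub = record
        { T′ = deepen T ; F-mono = λ z → z ; covers = λ () }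
      grow {r} r<a T (e ∷ todo) sub = result
        where
        g : Grown T todo
        g = grow r<a T todo (sub ∘ there)

        unchanged : (Incident (B T) e → e ∈ F (T′ g)) → Grown T (e ∷ todo)
        unchanged c = record
          { T′ = T′ g ; F-mono = F-mono g
          ; covers = λ { (here refl) → c ; (there q) → covers g q } }

        add : ∀ {z} → z ∈ vs → z ∉ B (T′ g) →
          Within (e ∷ F (T′ g)) z (suc r) → Grown T (e ∷ todo)
        add z∈ z∉ wz = record
          { T′ = extend (T′ g) e z∈ z∉ wz
          ; F-mono = there ∘ F-mono g
          ; covers = λ { (here refl) _ → here refl ; (there q) i → there (covers g q i) } }

        -- One end of the edge has depth at most `r`, the other at most `suc r`.
        short : r + suc r < 2 * a
        short = begin-strict
          r + suc r       <⟨ n<1+n _ ⟩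
          suc r + suc r   ≤⟨ +-mono-≤ r<a r<a ⟩
          a + a           ≡⟨ cong (a +_) (+-identityʳ a) ⟨
          2 * a           ∎
          where open ≤-Reasoning

        near : ∀ {x} → x ∈ B T → Within (F (T′ g)) x r
        near x∈ = within-mono (F-mono g) ≤-refl (depth T x∈)

        result : Grown T (e ∷ todo)
        result with e ∈E? F (T′ g)
        ... | yes e∈ = unchanged (λ _ → e∈)
        ... | no e∉ with src e ∈A? B T | tgt e ∈A? B T
        ...   | no s∉ | no t∉ = unchanged λ { (inj₁ q) → contradiction q s∉ ; (inj₂ q) → contradiction q t∉ }
        ...   | yes s∈ | _ with tgt e ∈A? B (T′ g)
        ...     | yes t∈ = contradiction (inj₁ (refl , refl)) (closes short e∉ (near s∈) (depth (T′ g) t∈))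
        ...     | no t∉ with near s∈
        ...       | l , l≤ , w = add (proj₂ (ends∈ (sub (here refl)))) t∉
                    (suc l , s≤s l≤ , subst (Path _ _ _) (+-comm l 1) (mapPath there w +++ forth (here refl) []))
        result | no e∉ | no _ | yes t∈ with src e ∈A? B (T′ g)
        ...     | yes s∈ = contradiction (inj₂ (refl , refl)) (closes short e∉ (near t∈) (depth (T′ g) s∈))
        ...     | no s∉ with near t∈
        ...       | l , l≤ , w = add (proj₁ (ends∈ (sub (here refl)))) s∉
                    (suc l , s≤s l≤ , subst (Path _ _ _) (+-comm l 1) (mapPath there w +++ back (here refl) []))

      record SparseSet : Set where
        field
          S : List A
          S-unique : Unique S
          S⊆ : ∀ {z} → z ∈ S → z ∈ vs
          v∈S : v ∈ S
          sparse : length (filter (incident? S) es) * s < k * length S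

      -- Balls cannot keep growing by a factor more than k / s, because |vs| < s ≤ (k / s) ^ a.
      sparseSet : v ∈ vs → length vs < s → SparseSet
      sparseSet v∈ vs<s = go a 0 (+-identityʳ a) start (≤-reflexive (+-identityʳ _))
        where
        start : Tree 0
        start = record
          { B = v ∷ [] ; F = [] ; B-unique = [] ∷ [] ; B⊆ = λ { (here refl) → v∈ }
          ; root∈ = here refl ; depth = λ { (here refl) → 0 , z≤n , [] } ; F<B = s≤s z≤n }
        -- The invariant is that the ball has at least (k / s) ^ r vertices, with denominators
        -- cleared; `d` is the distance of the radius from `a`.
        go : ∀ d r → d + r ≡ a → (T : Tree r) → k ^ r ≤ s ^ r * length (B T) → SparseSet
        go zero r refl T inv = contradiction (*-cancelˡ-≤ (s ^ r) ⦃ s^r≢0 ⦄ (begin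
          s ^ r * s             ≡⟨ *-comm (s ^ r) s ⟩
          s ^ suc r             ≤⟨ s^≤k^ ⟩
          k ^ r                 ≤⟨ inv ⟩
          s ^ r * length (B T)  ∎)) (<⇒≱ (≤-<-trans (unique-⊆⇒length≤ (B-unique T) (B⊆ T)) vs<s))
          where
          open ≤-Reasoning
          s^r≢0 : NonZero (s ^ r)
          s^r≢0 = m^n≢0 s r ⦃ >-nonZero s>0 ⦄
        go (suc d) r eq T inv = choose (length (B T⁺) * s ≤? k * length (B T))
          where
          open ≤-Reasoning
          g : Grown T es
          g = grow (subst (suc r ≤_) eq (s≤s (m≤n+m r d))) T es (λ z → z)
          T⁺ : Tree (suc r)
          T⁺ = T′ g
          -- All edges meeting the ball lie in the tree spanning the next ball. If that ball is at
          -- most k / s times as large, the present one is sparse; otherwise the invariant passes to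
          -- radius `suc r`.
          inc<B : length (filter (incident? (B T)) es) < length (B T⁺)
          inc<B = ≤-<-trans (unique-⊆⇒length≤ (Unique.filter⁺ (incident? (B T)) es-unique) sub) (F<B T⁺)
            where
            sub : ∀ {e} → e ∈ filter (incident? (B T)) es → e ∈ F T⁺
            sub e∈ with ∈-filter⁻ (incident? (B T)) e∈
            ... | e∈es , inc = covers g e∈es inc
          choose : Dec (length (B T⁺) * s ≤ k * length (B T)) → SparseSet
          choose (yes small) = record
            { S = B T ; S-unique = B-unique T ; S⊆ = B⊆ T ; v∈S = root∈ T
            ; sparse = <-≤-trans (*-monoˡ-< s ⦃ >-nonZero s>0 ⦄ inc<B) small }
          choose (no large) = go d (suc r) (trans (+-suc d r) eq) T⁺ (begin
            k * k ^ r                       ≤⟨ *-monoʳ-≤ k inv ⟩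
            k * (s ^ r * length (B T))      ≡⟨ x∙yz≈y∙xz k (s ^ r) (length (B T)) ⟩
            s ^ r * (k * length (B T))      ≤⟨ *-monoʳ-≤ (s ^ r) (<⇒≤ (≰⇒> large)) ⟩
            s ^ r * (length (B T⁺) * s)     ≡⟨ x∙yz≈zx∙y (s ^ r) (length (B T⁺)) s ⟩
            s * s ^ r * length (B T⁺)       ∎)

    -- Induction on the number of vertices. The strict inequality comes from the ball deleted first;
    -- what remains may be empty and satisfies only the weak one.
    edges-bound : ∀ (v : A) (vs : List A) (es : List E) → Unique (v ∷ vs) → Unique es →
      (∀ {e} → e ∈ es → src e ∈ v ∷ vs × tgt e ∈ v ∷ vs) → length (v ∷ vs) < s →
      length es * s < k * length (v ∷ vs)
    edges-bound v vs es = strict (length vs) v vs es ≤-refl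
      where
      weak : ∀ n vs es → length vs ≤ n → Unique vs → Unique es →
        (∀ {e} → e ∈ es → src e ∈ vs × tgt e ∈ vs) → length vs < s → length es * s ≤ k * length vs
      strict : ∀ n v vs es → length vs ≤ n → Unique (v ∷ vs) → Unique es →
        (∀ {e} → e ∈ es → src e ∈ v ∷ vs × tgt e ∈ v ∷ vs) → length (v ∷ vs) < s →
        length es * s < k * length (v ∷ vs)

      weak n [] [] le uv ue ends vs<s = z≤n
      weak n [] (e ∷ es) le uv ue ends vs<s with proj₁ (ends (here refl))
      ... | ()
      weak (suc n) (v ∷ vs) es (s≤s le) uv ue ends vs<s = <⇒≤ (strict n v vs es le uv ue ends vs<s)

      -- Remove a sparse ball together with the edges meeting it.
      strict n v vs es le uv ue ends vs<s = begin-strict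
        length es * s                            ≡⟨ cong (_* s) (length-filter-split meets? es) ⟨
        (length met + length es′) * s            ≡⟨ *-distribʳ-+ s (length met) (length es′) ⟩
        length met * s + length es′ * s          <⟨ +-mono-<-≤ sparse rest ⟩
        k * length S + k * length vs′            ≡⟨ *-distribˡ-+ k (length S) (length vs′) ⟨
        k * (length S + length vs′)              ≤⟨ *-monoʳ-≤ k S+vs′≤ ⟩
        k * length (v ∷ vs)                      ∎
        where
        open ≤-Reasoning
        open Ball.SparseSet (Ball.sparseSet (v ∷ vs) es ue ends v (here refl) vs<s)
        meets? : Decidable (Incident S)
        meets? = incident? S
        outside? : Decidable (_∉ S)
        outside? z = ¬? (z ∈A? S)
        met es′ : List E
        met = filter meets? es
        es′ = filter (¬? ∘ meets?) es
        vs′ : List A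
        vs′ = filter outside? (v ∷ vs)
        vs′-unique : Unique vs′
        vs′-unique = Unique.filter⁺ outside? uv
        S+vs′≤ : length S + length vs′ ≤ length (v ∷ vs)
        S+vs′≤ = subst (_≤ _) (length-++ S)
          (unique-⊆⇒length≤
            (Unique.++⁺ S-unique vs′-unique λ (z∈S , z∈) → proj₂ (∈-filter⁻ outside? {xs = v ∷ vs} z∈) z∈S)
            sub)
          where
          sub : ∀ {z} → z ∈ S ++ vs′ → z ∈ v ∷ vs
          sub z∈ with ∈-++⁻ S z∈
          ... | inj₁ z∈S = S⊆ z∈S
          ... | inj₂ z∈vs′ = proj₁ (∈-filter⁻ outside? z∈vs′)
        S>0 : 0 < length S
        S>0 = unique-⊆⇒length≤ ([] ∷ []) λ { (here refl) → v∈S }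
        vs′≤n : length vs′ ≤ n
        vs′≤n = ≤-trans (s≤s⁻¹ (≤-trans (+-monoˡ-≤ (length vs′) S>0) S+vs′≤)) le
        rest : length es′ * s ≤ k * length vs′
        rest = weak n vs′ es′ vs′≤n vs′-unique (Unique.filter⁺ (¬? ∘ meets?) ue) ends′
          (≤-<-trans (≤-trans (m≤n+m _ (length S)) S+vs′≤) vs<s)
          where
          ends′ : ∀ {e} → e ∈ es′ → src e ∈ vs′ × tgt e ∈ vs′
          ends′ e∈ with ∈-filter⁻ (¬? ∘ meets?) {xs = es} e∈
          ... | e∈es , ¬inc = ∈-filter⁺ outside? (proj₁ (ends e∈es)) (¬inc ∘ inj₁)
                            , ∈-filter⁺ outside? (proj₂ (ends e∈es)) (¬inc ∘ inj₂)

-- Double counting and common neighbours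

length-cartesianProduct : ∀ {A B : Set} (xs : List A) (ys : List B) →
  length (cartesianProduct xs ys) ≡ length xs * length ys
length-cartesianProduct [] ys = refl
length-cartesianProduct (x ∷ xs) ys = trans (length-++ (map (x ,_) ys))
  (cong₂ _+_ (length-map (x ,_) ys) (length-cartesianProduct xs ys))

fibres-bound : ∀ {A B : Set} (_≟_ : DecidableEquality B) (key : A → B) (q : ℕ) (P : Pred A 0ℓ) →
  (∀ y xs → Unique xs → (∀ {x} → x ∈ xs → P x × key x ≡ y) → length xs ≤ q) →
  ∀ ys xs → Unique xs → (∀ {x} → x ∈ xs → P x × key x ∈ ys) → length xs ≤ length ys * q
fibres-bound _≟_ key q P fibre [] [] u h = z≤n
fibres-bound _≟_ key q P fibre [] (x ∷ xs) u h with proj₂ (h (here refl))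
... | ()
fibres-bound _≟_ key q P fibre (y ∷ ys) xs u h = begin
  length xs                                                 ≡⟨ length-filter-split on-y? xs ⟨
  length (filter on-y? xs) + length (filter (¬? ∘ on-y?) xs) ≤⟨ +-mono-≤
    (fibre y _ (Unique.filter⁺ on-y? u) λ x∈ → let x∈xs , eq = ∈-filter⁻ on-y? x∈ in proj₁ (h x∈xs) , eq)
    (fibres-bound _≟_ key q P fibre ys _ (Unique.filter⁺ (¬? ∘ on-y?) u) rest) ⟩
  q + length ys * q                                         ∎
  where
  open ≤-Reasoning
  on-y? : Decidable (λ x → key x ≡ y)
  on-y? x = key x ≟ y
  rest : ∀ {x} → x ∈ filter (¬? ∘ on-y?) xs → P x × key x ∈ ys
  rest x∈ with ∈-filter⁻ (¬? ∘ on-y?) {xs = xs} x∈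
  ... | x∈xs , ne with h x∈xs
  ...   | p , here eq = contradiction eq ne
  ...   | p , there k∈ = p , k∈

-- The vertices 0 and 1 go to `p` and `u`. Each `f i` differs from both because it is adjacent to
-- both.
commonNeighbours⇒K2r : ∀ {n r} (G : Graph n) {p u : Fin n} (f : Fin r → Fin n) → p ≢ u →
  (∀ {i j} → f i ≡ f j → i ≡ j) → (∀ i → f i ∼[ G ] p × f i ∼[ G ] u) →
  IsSubgraphOf (completeBipartite 2 r) G
commonNeighbours⇒K2r {n} {r} G {p} {u} f p≢u f-inj f∼ = h , inj , edge
  where
  h : Fin (2 + r) → Fin n
  h zero = p
  h (suc zero) = u
  h (suc (suc i)) = f i
  inj : ∀ {i j} → h i ≡ h j → i ≡ j
  inj {zero} {zero} eq = refl
  inj {zero} {suc zero} eq = contradiction eq p≢u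
  inj {zero} {suc (suc j)} eq = contradiction (≡-sym eq) (∼⇒≢ G (proj₁ (f∼ j)))
  inj {suc zero} {zero} eq = contradiction (≡-sym eq) p≢u
  inj {suc zero} {suc zero} eq = refl
  inj {suc zero} {suc (suc j)} eq = contradiction (≡-sym eq) (∼⇒≢ G (proj₂ (f∼ j)))
  inj {suc (suc i)} {zero} eq = contradiction eq (∼⇒≢ G (proj₁ (f∼ i)))
  inj {suc (suc i)} {suc zero} eq = contradiction eq (∼⇒≢ G (proj₂ (f∼ i)))
  inj {suc (suc i)} {suc (suc j)} eq = cong (λ k → suc (suc k)) (f-inj eq)
  edge : ∀ i j → i ∼[ completeBipartite 2 r ] j → h i ∼[ G ] h j
  edge zero (suc (suc j)) e = ∼-sym G (proj₁ (f∼ j))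
  edge (suc zero) (suc (suc j)) e = ∼-sym G (proj₂ (f∼ j))
  edge (suc (suc i)) zero e = proj₁ (f∼ i)
  edge (suc (suc i)) (suc zero) e = proj₂ (f∼ i)
  edge zero zero ()
  edge zero (suc zero) ()
  edge (suc zero) zero ()
  edge (suc zero) (suc zero) ()
  edge (suc (suc i)) (suc (suc j)) ()

-- Counting the colours of a stuck embedding

module StuckLinks {N K s : ℕ} (G : Graph N) (c : Fin N → Fin (suc K)) (grundy : IsGrundy G c)
  (stuck : Greedy.Stuck {s = s} G c grundy) where

  open Greedy {s = s} G c grundy
  open Stuck stuck

  link : (e : Fin K) → Link xs (toℕ e)
  link e = links (toℕ e) (Fin.toℕ<n e)

  a b w : Fin K → Fin N
  a e = Link.a (link e)
  b e = Link.b (link e)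
  w e = Link.w (link e)

  w-injective : ∀ {e e′} → w e ≡ w e′ → e ≡ e′
  w-injective {e} {e′} eq = Fin.toℕ-injective
    (trans (≡-sym (Link.col-w (link e))) (trans (cong col eq) (Link.col-w (link e′))))

  -- The edges are the colours below `K`: the colour `e` joins `a e` to `b e`, by a tree edge if
  -- `w e` is `a e`, and through the rejected vertex `w e` otherwise.
  open Multigraph Fin._≟_ Fin._≟_ a b

  module _ (e : Fin K) where

    -- The single forbidden step runs along the edge of `G` with which the detour is later closed to
    -- a cycle.
    Avoiding : Rel (Fin N) 0ℓ
    Avoiding u v = u ∼[ G ] v × ¬ (u ≡ w e × v ≡ b e)

    up : ∀ {e′ z} → e′ ≢ e → w e′ ∼[ G ] z → Avoiding (w e′) z
    up e′≢e wz = wz , λ (eq , _) → e′≢e (w-injective eq)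

    -- If this were the forbidden step, `z` would be `w e` and `w e′` would be `b e`. Comparing
    -- colours, `e′` would be smaller than `e` and `e` smaller than `e′`.
    down : ∀ {e′ z} → w e′ ∼[ G ] z → toℕ e′ < col z → Avoiding z (w e′)
    down {e′} {z} wz e′<z = ∼-sym G wz , λ (z≡w , w′≡b) → <-asym
      (subst (toℕ e′ <_) (trans (cong col z≡w) (Link.col-w (link e))) e′<z)
      (subst (toℕ e <_) (trans (≡-sym (cong col w′≡b)) (Link.col-w (link e′))) (Link.i<b (link e)))

    -- A tree edge becomes one step in `G` and an edge through a rejected vertex becomes two; the
    -- starting vertex adds one.
    path⇒walk : ∀ {x y l} → Path (_≢ e) x y l →
      ∃ λ vs → Walk Avoiding x y vs × length vs ≤ suc (2 * l)
    path⇒walk [] = _ , [ _ ] , ≤-refl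
    path⇒walk {l = suc l} (forth {e′} e′≢e p) with path⇒walk p | Link.wa (link e′)
    ... | vs , v , le | inj₁ w≡a = w e′ ∷ vs , subst (λ z → Walk Avoiding z _ (w e′ ∷ vs)) w≡a (up e′≢e (Link.wb (link e′)) ∷ v)
                                 , s≤s (≤-trans le (+-monoʳ-≤ (suc l) (n≤1+n _)))
    ... | vs , v , le | inj₂ (wa , i<a) = _ , down wa i<a ∷ (up e′≢e (Link.wb (link e′)) ∷ v)
                                 , s≤s (≤-trans (s≤s le) (≤-reflexive (cong suc (≡-sym (+-suc l _)))))
    path⇒walk {l = suc l} (back {e′} e′≢e p) with path⇒walk p | Link.wa (link e′)
    ... | vs , v , le | inj₁ w≡a = _ , subst (Avoiding (b e′)) w≡a (down (Link.wb (link e′)) (Link.i<b (link e′))) ∷ v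
                                 , s≤s (≤-trans le (+-monoʳ-≤ (suc l) (n≤1+n _)))
    ... | vs , v , le | inj₂ (wa , i<a) = _ , down (Link.wb (link e′)) (Link.i<b (link e′)) ∷ (up e′≢e wa ∷ v)
                                 , s≤s (≤-trans (s≤s le) (≤-reflexive (cong suc (≡-sym (+-suc l _)))))

    path⇒cycle : ∀ {l} → Path (_≢ e) (a e) (b e) l → ∃ λ ℓ → ℓ ≤ 2 * suc l × HasCycleOfLength G ℓ
    path⇒cycle {l} p = close (Link.wa (link e)) (path⇒walk p)
      where
      close : w e ≡ a e ⊎ (w e ∼[ G ] a e × toℕ e < col (a e)) →
        (∃ λ vs → Walk Avoiding (a e) (b e) vs × length vs ≤ suc (2 * l)) →
        ∃ λ ℓ → ℓ ≤ 2 * suc l × HasCycleOfLength G ℓ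
      finish : ∀ {vs} → Walk Avoiding (w e) (b e) vs → length vs ≤ suc (suc (2 * l)) →
        ∃ λ ℓ → ℓ ≤ 2 * suc l × HasCycleOfLength G ℓ
      close (inj₁ w≡a) (vs , v , le) =
        finish (subst (λ z → Walk Avoiding z (b e) vs) (≡-sym w≡a) v) (m≤n⇒m≤1+n le)
      -- For a rejected `w e` the walk is first extended by the step to `a e`, which is allowed
      -- since `a e` differs from `b e`.
      close (inj₂ (wa , _)) (vs , v , le) = finish ((wa , Link.a≢b (link e) ∘ proj₂) ∷ v) (s≤s le)
      finish v le with detour⇒cycle G (Link.wb (link e)) proj₁ (λ (_ , ne) → ne (refl , refl)) v
      ... | ℓ , ℓ≤ , cyc = ℓ , ≤-trans ℓ≤ (≤-trans le (≤-reflexive (cong suc (≡-sym (+-suc l _))))) , cyc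

  short-cycle : ∀ {m} → s ^ suc m ≤ suc K ^ m → s ≤ suc K →
    ¬ (∀ ℓ → ℓ ≤ 4 * m → ¬ HasCycleOfLength G ℓ)
  short-cycle {m} s^≤k^ s≤k noCycle = contra xs xs-unique (λ e → Link.a∈ (link e) , Link.b∈ (link e)) root∈ few
    where
    open ≤-Reasoning
    detour-long : ∀ e {l} → Path (_≢ e) (a e) (b e) l → 2 * m ≤ l
    detour-long e {l} p with path⇒cycle e p
    ... | ℓ , ℓ≤ , cyc = ≮⇒≥ λ l<2m → noCycle ℓ (begin
      ℓ               ≤⟨ ℓ≤ ⟩
      2 * suc l       ≤⟨ *-monoʳ-≤ 2 l<2m ⟩
      2 * (2 * m)     ≡⟨ *-assoc 2 2 m ⟨
      4 * m           ∎) cyc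
    contra : ∀ ys → Unique ys → (∀ e → a e ∈ ys × b e ∈ ys) → root ∈ ys → length ys < s → ⊥
    -- The `K` edges lie on fewer than `s` vertices. The edge bound then forces `suc K < s`, against
    -- `s≤k`.
    contra (y ∷ ys) uniq ends _ ys<s = <⇒≱ (+-cancelˡ-< (K * s) _ _ (begin-strict
      K * s + suc K                              ≡⟨ +-comm (K * s) (suc K) ⟩
      suc K + K * s                              <⟨ +-monoʳ-< (suc K) few-edges ⟩
      suc K + suc K * length (y ∷ ys)            ≡⟨ *-suc (suc K) _ ⟨
      suc K * suc (length (y ∷ ys))              ≤⟨ *-monoʳ-≤ (suc K) ys<s ⟩
      suc K * s                                  ≡⟨ +-comm s (K * s) ⟩
      K * s + s                                  ∎)) s≤k
      where
      few-edges : K * s < suc K * length (y ∷ ys)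
      few-edges = subst (λ n → n * s < suc K * length (y ∷ ys)) (length-tabulate {n = K} (λ i → i))
        (Sparse.edges-bound m s (suc K) (≤-<-trans z≤n ys<s) s^≤k^ detour-long y ys (allFin K)
          uniq (Unique.allFin⁺ K) (λ {e} _ → ends e) ys<s)

  direct? : Decidable (λ e → w e ≡ a e)
  direct? e = w e Fin.≟ a e

  rejected : List (Fin K)
  rejected = filter (¬? ∘ direct?) (allFin K)

  -- If `w e` is `a e`, the colour is carried by an embedded vertex. Different colours have
  -- different such vertices, and none of them is `root`, whose colour is `K`; so these colours and
  -- `K` number at most `length xs`.
  colours≤ : suc K ≤ length xs + length rejected
  colours≤ = begin
    suc K                                     ≡⟨ cong suc (length-tabulate {n = K} (λ i → i)) ⟨
    suc (length (allFin K))                   ≡⟨ cong suc (length-filter-split direct? (allFin K)) ⟨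
    suc (length direct) + length rejected     ≡⟨ cong (λ n → suc n + length rejected) (length-map w direct) ⟨
    length (root ∷ map w direct) + length rejected ≤⟨ +-monoˡ-≤ (length rejected) (unique-⊆⇒length≤ uniq sub) ⟩
    length xs + length rejected               ∎
    where
    open ≤-Reasoning
    direct : List (Fin K)
    direct = filter direct? (allFin K)
    root∉ : root ∉ map w direct
    root∉ r∈ with ∈-map⁻ w r∈
    ... | e , _ , refl = <-irrefl (trans (≡-sym (Link.col-w (link e))) root-col) (Fin.toℕ<n e)
    uniq : Unique (root ∷ map w direct)
    uniq = ¬Any⇒All¬ _ root∉ ∷ Unique.map⁺ w-injective (Unique.filter⁺ direct? (Unique.allFin⁺ K))
    sub : ∀ {z} → z ∈ root ∷ map w direct → z ∈ xs
    sub (here refl) = root∈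
    sub (there z∈) with ∈-map⁻ w z∈
    ... | e , e∈ , refl = subst (_∈ xs) (≡-sym (proj₂ (∈-filter⁻ direct? {xs = allFin K} e∈))) (Link.a∈ (link e))

  -- Each rejected vertex is counted for both orders of its two neighbours in xs,
  -- which accounts for the factor 1/2 in the bound.
  rejected-bound : ∀ {r} → 1 ≤ r → K2r-free r G → 2 * length rejected ≤ length xs * length xs * (r ∸ 1)
  rejected-bound {r} r≥1 free = begin
    2 * length rejected                             ≡⟨ *-comm 2 (length rejected) ⟩
    length rejected * 2                             ≡⟨ length-cartesianProduct rejected sides ⟨
    length (cartesianProduct rejected sides)        ≤⟨ fibres-bound (≡-dec Fin._≟_ Fin._≟_) key (r ∸ 1) Rejected fibre
                                                         (cartesianProduct xs xs) _
                                                         (Unique.cartesianProduct⁺ (Unique.filter⁺ (¬? ∘ direct?) (Unique.allFin⁺ K)) sides-unique) all ⟩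
    length (cartesianProduct xs xs) * (r ∸ 1)       ≡⟨ cong (_* (r ∸ 1)) (length-cartesianProduct xs xs) ⟩
    length xs * length xs * (r ∸ 1)                 ∎
    where
    open ≤-Reasoning
    sides : List Bool
    sides = true ∷ false ∷ []
    sides-unique : Unique sides
    sides-unique = ((λ ()) ∷ []) ∷ ([] ∷ [])
    key : Fin K × Bool → Fin N × Fin N
    key (e , true) = a e , b e
    key (e , false) = b e , a e
    Rejected : Pred (Fin K × Bool) 0ℓ
    Rejected (e , _) = w e ≢ a e
    all : ∀ {x} → x ∈ cartesianProduct rejected sides → Rejected x × key x ∈ cartesianProduct xs xs
    all {e , side} x∈ = proj₂ (∈-filter⁻ (¬? ∘ direct?) {xs = allFin K} (proj₁ (∈-cartesianProduct⁻ rejected sides x∈)))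
                    , key∈ side
      where
      key∈ : ∀ side → key (e , side) ∈ cartesianProduct xs xs
      key∈ true = ∈-cartesianProduct⁺ (Link.a∈ (link e)) (Link.b∈ (link e))
      key∈ false = ∈-cartesianProduct⁺ (Link.b∈ (link e)) (Link.a∈ (link e))
    neighbours : ∀ x → Rejected x → w (proj₁ x) ∼[ G ] proj₁ (key x) × w (proj₁ x) ∼[ G ] proj₂ (key x)
    neighbours (e , side) w≢a with Link.wa (link e)
    neighbours (e , side) w≢a | inj₁ w≡a = contradiction w≡a w≢a
    neighbours (e , true) w≢a | inj₂ (wa , _) = wa , Link.wb (link e)
    neighbours (e , false) w≢a | inj₂ (wa , _) = Link.wb (link e) , wa
    distinct : ∀ x → proj₁ (key x) ≢ proj₂ (key x)
    distinct (e , true) eq = Link.a≢b (link e) eq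
    distinct (e , false) eq = Link.a≢b (link e) (≡-sym eq)
    -- Inside a fibre of `key`, the vertex `w` determines the order of the pair as well, because
    -- `a e` and `b e` differ. Hence `r` elements of one fibre give `r` distinct common neighbours.
    determined : ∀ x x′ → key x ≡ key x′ → w (proj₁ x) ≡ w (proj₁ x′) → x ≡ x′
    determined (e , side) (e′ , side′) keys eq with w-injective eq
    determined (e , true) (e , true) keys eq | refl = refl
    determined (e , false) (e , false) keys eq | refl = refl
    determined (e , true) (e , false) keys eq | refl = contradiction (cong proj₁ keys) (Link.a≢b (link e))
    determined (e , false) (e , true) keys eq | refl = contradiction (cong proj₂ keys) (Link.a≢b (link e))
    fibre : ∀ y zs → Unique zs → (∀ {x} → x ∈ zs → Rejected x × key x ≡ y) → length zs ≤ r ∸ 1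
    fibre y zs u h = ≮⇒≥ λ r-1<zs → free (K2r (subst (_≤ length zs) (m+[n∸m]≡n r≥1) r-1<zs))
      where
      K2r : r ≤ length zs → IsSubgraphOf (completeBipartite 2 r) G
      K2r r≤ = commonNeighbours⇒K2r G (w ∘ proj₁ ∘ at) p≢u inj nb
        where
        at : Fin r → Fin K × Bool
        at i = lookup zs (inject≤ i r≤)
        ok : ∀ i → Rejected (at i) × key (at i) ≡ y
        ok i = h (∈-lookup (inject≤ i r≤))
        inj : ∀ {i j} → w (proj₁ (at i)) ≡ w (proj₁ (at j)) → i ≡ j
        inj {i} {j} eq = Fin.inject≤-injective r≤ r≤ i j (unique-lookup-injective u
          (determined (at i) (at j) (trans (proj₂ (ok i)) (≡-sym (proj₂ (ok j)))) eq))
        nb : ∀ i → w (proj₁ (at i)) ∼[ G ] proj₁ y × w (proj₁ (at i)) ∼[ G ] proj₂ y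
        nb i = subst (λ k → w (proj₁ (at i)) ∼[ G ] proj₁ k × w (proj₁ (at i)) ∼[ G ] proj₂ k)
          (proj₂ (ok i)) (neighbours (at i) (proj₁ (ok i)))
        p≢u : proj₁ y ≢ proj₂ y
        p≢u = subst (λ k → proj₁ k ≢ proj₂ k) (proj₂ (ok (fromℕ< r≥1))) (distinct (at (fromℕ< r≥1)))

  -- Since `n < s`, more than `t / 2` colours are rejected. Rounding down loses nothing here: twice
  -- their number exceeds `t`, whereas the double count allows at most `t`.
  ¬K2r-free : ∀ {r} → 1 ≤ r → ((r ∸ 1) * ((s ∸ 1) * s)) / 2 + s ≤ suc K → ¬ K2r-free r G
  ¬K2r-free {r} r≥1 bound free = <-irrefl refl (begin-strict
    t                            ≡⟨ m≡m%n+[m/n]*n t 2 ⟩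
    t % 2 + t / 2 * 2            <⟨ +-monoˡ-< (t / 2 * 2) (m%n<n t 2) ⟩
    2 + t / 2 * 2                ≤⟨ *-monoˡ-≤ 2 t/2<rejected ⟩
    length rejected * 2          ≡⟨ *-comm (length rejected) 2 ⟩
    2 * length rejected          ≤⟨ rejected-bound r≥1 free ⟩
    n * n * (r ∸ 1)              ≡⟨ *-comm (n * n) (r ∸ 1) ⟩
    (r ∸ 1) * (n * n)            ≤⟨ *-monoʳ-≤ (r ∸ 1) (*-mono-≤ (<⇒≤pred few) (<⇒≤ few)) ⟩
    t                            ∎)
    where
    open ≤-Reasoning
    n t : ℕ
    n = length xs
    t = (r ∸ 1) * ((s ∸ 1) * s)
    t/2<rejected : t / 2 < length rejected
    t/2<rejected = +-cancelˡ-< n _ _ (begin-strict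
      n + t / 2             <⟨ +-monoˡ-< (t / 2) few ⟩
      s + t / 2             ≡⟨ +-comm s (t / 2) ⟩
      t / 2 + s             ≤⟨ bound ⟩
      suc K                 ≤⟨ colours≤ ⟩
      n + length rejected   ∎)

-- Exponents in the girth condition

^-cancelˡ-≤ : ∀ n .⦃ _ : NonZero n ⦄ {x y} → x ^ n ≤ y ^ n → x ≤ y
^-cancelˡ-≤ n le = ≮⇒≥ λ y<x → <⇒≱ (^-monoˡ-< n y<x) le

-- The hypothesis is the bound on the chromatic number raised to the power `g ∸ 4`. The number `m`
-- is the largest with `4 * m < g`, and multiplying by `s ^ d ≤ k ^ d` fills the exponent `g` up to
-- `suc m * 4`; then fourth roots are taken.
girth-exponents : ∀ s k g .⦃ _ : NonZero k ⦄ → 5 ≤ g → s ^ g ≤ k ^ (g ∸ 4) →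
  s ≤ k × ∃ λ m → 4 * m < g × s ^ suc m ≤ k ^ m
girth-exponents s k (suc h) g≥5 s^≤k^ = s≤k , m , s≤s 4m≤h , ^-cancelˡ-≤ 4 (begin
  (s ^ suc m) ^ 4                       ≡⟨ ^-*-assoc s (suc m) 4 ⟩
  s ^ (suc m * 4)                       ≡⟨ cong (s ^_) (m+[n∸m]≡n h<4m+4) ⟨
  s ^ (suc h + d)                       ≡⟨ ^-distribˡ-+-* s (suc h) d ⟩
  s ^ suc h * s ^ d                     ≤⟨ *-mono-≤ s^≤k^ (^-monoˡ-≤ d s≤k) ⟩
  k ^ (suc h ∸ 4) * k ^ d               ≡⟨ ^-distribˡ-+-* k (suc h ∸ 4) d ⟨
  k ^ (suc h ∸ 4 + d)                   ≡⟨ cong (k ^_) exponent ⟩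
  k ^ (m * 4)                           ≡⟨ ^-*-assoc k m 4 ⟨
  (k ^ m) ^ 4                           ∎)
  where
  open ≤-Reasoning
  m d : ℕ
  m = h / 4
  d = suc m * 4 ∸ suc h
  s≤k : s ≤ k
  s≤k = ^-cancelˡ-≤ (suc h) (≤-trans s^≤k^ (^-monoʳ-≤ k (m∸n≤m (suc h) 4)))
  4m≤h : 4 * m ≤ h
  4m≤h = subst (_≤ h) (*-comm m 4) (m/n*n≤m h 4)
  h<4m+4 : suc h ≤ suc m * 4
  h<4m+4 = begin-strict
    h                 ≡⟨ m≡m%n+[m/n]*n h 4 ⟩
    h % 4 + m * 4     <⟨ +-monoˡ-< (m * 4) (m%n<n h 4) ⟩
    suc m * 4         ∎
  exponent : suc h ∸ 4 + d ≡ m * 4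
  exponent = +-cancelˡ-≡ 4 _ _ (begin-equality
    4 + (suc h ∸ 4 + d)      ≡⟨ +-assoc 4 (suc h ∸ 4) d ⟨
    4 + (suc h ∸ 4) + d      ≡⟨ cong (_+ d) (m+[n∸m]≡n (<⇒≤ g≥5)) ⟩
    suc h + d                ≡⟨ m+[n∸m]≡n h<4m+4 ⟩
    4 + m * 4                ∎)

-- Assembling the two cases

theorem23 : (s : ℕ) → 1 ≤ s → (n : ℕ) (G : Graph n) (k : ℕ) → IsChromaticNumber G k →
    ((Σ ℕ λ r → 2 ≤ r × K2r-free r G × ((r ∸ 1) * ((s ∸ 1) * s)) / 2 + s ≤ k)
    ⊎ (Σ ℕ λ g → 5 ≤ g × HasGirth G g × s ^ g ≤ k ^ (g ∸ 4))) →
    Σ (Fin n → Fin k) λ c → IsProperColoring G c × AllTreesInducedRainbow s G c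
theorem23 s s≥1 n G zero χ (inj₁ (r , r≥2 , free , bound)) =
  contradiction (≤-trans s≥1 (m+n≤o⇒n≤o _ bound)) λ ()
-- Writing `g` as `5 + o` makes the exponent `g ∸ 4` a successor, so the power of zero reduces to
-- zero while `s ^ g` is positive.
theorem23 s s≥1 n G zero χ (inj₂ (g , g≥5 , girth , bound)) with m≤n⇒∃[o]m+o≡n g≥5
... | o , refl = contradiction (≤-trans (m^n>0 s ⦃ >-nonZero s≥1 ⦄ g) bound) λ ()
theorem23 s s≥1 n G (suc K) ((c₀ , proper₀) , optimal) cases
  with grundyColoring G c₀ proper₀
... | c , proper , grundy with topColour-used G c proper (optimal K ≤-refl)
-- The colouring and the root are fixed before any tree is given, so one colouring serves all trees.
...   | root , root-col = c , proper , embed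
  where
  open Greedy {s = s} G c grundy using (Stuck; embed-or-stuck)
  ¬stuck : ¬ Stuck
  ¬stuck stuck = case cases of λ where
      (inj₁ (r , r≥2 , free , bound)) → ¬K2r-free (<⇒≤ r≥2) bound free
      (inj₂ (g , g≥5 , (_ , noShort) , bound)) →
        let s≤k , m , 4m<g , s^≤k^ = girth-exponents s (suc K) g g≥5 bound
        in short-cycle {m} s^≤k^ s≤k λ ℓ ℓ≤4m → noShort ℓ (≤-<-trans ℓ≤4m 4m<g)
    where open StuckLinks G c grundy stuck
  embed : AllTreesInducedRainbow s G c
  embed T tree with embed-or-stuck T tree root root-col (fromℕ< s≥1)
  ... | inj₁ e = e
  ... | inj₂ stuck = contradiction stuck ¬stuck
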